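{- For all integers $n,k\geq 0$, \begin{align*} c_{11,3}\left(2^{3k+5}n+\frac{3\cdot 2^{3k+3}+4}{7}\right)&\equiv 0\pmod 2,\\ c_{11,3}\left(2^{3k+6}n+\frac{19\cdot 2^{3k+4}+4}{7}\right)&\equiv 0\pmod 2,\\ c_{11,3}\left(2^{3k+7}n+\frac{27\cdot 2^{3k+5}+4}{7}\right)&\equiv 0\pmod 2. \end{align*}
   Context: For complex $a,b$ the false theta function is $\Psi(a,b):=\sum_{n=0}^\infty a^{n(n+1)/2}b^{n(n-1)/2}-\sum_{n=-\infty}^{ -1}a^{n(n+1)/2}b^{n(n-1)/2}$. For positive integers $r,s$, the integers $c_{r,s}(n)$ ($n\ge 0$) are defined by the power series identity $\sum_{n=0}^\infty c_{r,s}(n)q^n=\dfrac{1}{\Psi(-q^r,q^s)}$ (the denominator is a power series in $q$ with constant term $1$). -}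

module Defs where

open import Data.Nat as ℕ using (ℕ; zero; suc)
open import Data.Nat.DivMod using (_/_; _%_)
open import Data.Integer as ℤ using (ℤ)
open import Data.List using (List; []; _∷_; map; zipWith; upTo; foldr)
open import Data.Bool using (if_then_else_)

sumℤ : List ℤ → ℤ
sumℤ = foldr ℤ._+_ ℤ.0ℤ

sgn : ℕ → ℤ
sgn t = if (t % 2) ℕ.≡ᵇ 0 then ℤ.1ℤ else ℤ.-1ℤ

tri : ℕ → ℕ
tri n = (n ℕ.* suc n) / 2

ind : ℕ → ℕ → ℤ
ind m N = if m ℕ.≡ᵇ N then ℤ.1ℤ else ℤ.0ℤ

-- Coefficient of q^N in Ψ(-q^r, q^s)
--   = Σ_{n≥0} (-1)^{n(n+1)/2} q^{r n(n+1)/2 + s n(n-1)/2}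
--   - Σ_{m≥1} (-1)^{m(m-1)/2} q^{r m(m-1)/2 + s m(m+1)/2}
-- (for n = -m ≤ -1: n(n+1)/2 = m(m-1)/2, n(n-1)/2 = m(m+1)/2).
-- Since r,s ≥ 1 every exponent with index n is ≥ n, so indices n ≤ N suffice.
posTerm : ℕ → ℕ → ℕ → ℕ → ℤ
posTerm r s N n = sgn (tri n) ℤ.* ind (r ℕ.* tri n ℕ.+ s ℕ.* (tri n ℕ.∸ n)) N

negTerm : ℕ → ℕ → ℕ → ℕ → ℤ
negTerm r s N m = sgn (tri m ℕ.∸ m) ℤ.* ind (r ℕ.* (tri m ℕ.∸ m) ℕ.+ s ℕ.* tri m) N

psiCoeff : ℕ → ℕ → ℕ → ℤ
psiCoeff r s N =
  sumℤ (map (posTerm r s N) (upTo (suc N)))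
  ℤ.- sumℤ (map (λ i → negTerm r s N (suc i)) (upTo (suc N)))

-- cList r s N = [ c(N) , c(N-1) , ... , c(0) ] for 1/Ψ(-q^r,q^s),
-- computed by the recursion c(0) = 1 (psiCoeff r s 0 = 1),
-- c(N) = - Σ_{j=1}^{N} psiCoeff(j) c(N-j).
cList : ℕ → ℕ → ℕ → List ℤ
cList r s zero = ℤ.1ℤ ∷ []
cList r s (suc N) =
  ℤ.- sumℤ (zipWith ℤ._*_ (map (λ i → psiCoeff r s (suc i)) (upTo (suc N))) (cList r s N))
  ∷ cList r s N

headZ : List ℤ → ℤ
headZ [] = ℤ.0ℤ
headZ (x ∷ _) = x

c : ℕ → ℕ → ℕ → ℤ
c r s N = headZ (cList r s N)

{-# OPTIONS --safe #-}

-- Modulo 2 the denominator is T = Σ q^(7k²+4k) over k ∈ ℤ, and its reciprocal D satisfies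
-- D = T D² = T(q) D(q²).  Put S = Σ q^(7k²+2k) and W = q Σ q^(7k²+6k).  Then T has even part
-- S(q⁴), and rotating the lattice by 45° shows that the odd part of S T is q (T W)(q²).
-- Taking sections three times turns these facts into Σ D(8n+4) qⁿ = T W S D = W S.  The n-th
-- coefficient of W S counts the representations 7n + 3 = x² + y² with x ≡ 1, y ≡ 3 (mod 7),
-- and in all three progressions 7n + 3 is a power of 2 times a number ≡ 3 (mod 4).

module Submission where

open import Defs
open import Data.Nat using (ℕ; _+_; _*_; _^_)
open import Data.Nat.DivMod using (_/_)
open import Data.Integer using (+_)
open import Data.Integer.Divisibility using (_∣_)
open import Data.Product using (_×_)

open import Algebra.Bundles using (CommutativeMonoid; CommutativeRing)
import Algebra.Properties.CommutativeSemigroup as CommutativeSemigroupProperties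
import Algebra.Solver.CommutativeMonoid as CommutativeMonoidSolver
open import Data.Bool using (Bool; true; false; not; _∧_; _xor_)
open import Data.Bool.Properties
  using (∧-assoc; ∧-comm; ∧-idem; ∧-zeroʳ; ∧-distribˡ-xor; ∧-distribʳ-xor; xor-assoc; xor-comm; xor-same;
         xor-identityʳ; not-involutive; not-distribˡ-xor; xor-annihilates-not; xor-∧-commutativeRing)
open import Data.Empty using (⊥; ⊥-elim)
open import Data.Integer as ℤ using (ℤ; -[1+_]; ∣_∣; _⊖_)
open import Data.Integer.Properties as ℤ
  using (+-injective; -[1+-injective; [1+m]⊖[1+n]≡m⊖n; abs-*; ∣-i∣≡∣i∣; pos-*; *-cancelˡ-≡)
open import Data.Integer.Tactic.RingSolver using () renaming (solve-∀ to ℤ-solve-∀)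
open import Data.List
  using (List; []; _∷_; _++_; map; filter; length; zipWith; upTo; applyUpTo; cartesianProduct)
open import Data.List.Membership.Propositional using (_∈_)
open import Data.List.Membership.Propositional.Properties
  using (∈-filter⁺; ∈-filter⁻; ∈-map⁺; ∈-map⁻; ∈-++⁺ˡ; ∈-++⁺ʳ; ∈-upTo⁺; ∈-cartesianProduct⁺)
open import Data.List.Membership.Propositional.Properties.WithK using (unique∧set⇒bag)
open import Data.List.Properties using (length-map; map-applyUpTo; map-upTo)
open import Data.List.Relation.Binary.BagAndSetEquality using (∼bag⇒↭)
open import Data.List.Relation.Binary.Permutation.Propositional.Properties using (↭-length)
open import Data.List.Relation.Unary.Unique.Propositional using (Unique)
import Data.List.Relation.Unary.Unique.Propositional.Properties as Unique
open import Data.Nat using (zero; suc; _∸_; _≤_; z≤n; s≤s; _≡ᵇ_; _≟_)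
open import Data.Nat.Divisibility using (divides; _∣0; ∣-refl; ∣m∣n⇒∣m+n) renaming (_∣_ to _∣ℕ_)
open import Data.Nat.DivMod using (_%_; +-distrib-/-∣ˡ; m*n/n≡m)
open import Data.Nat.Properties
  using (≤-refl; ≤-trans; m≤n⇒m≤1+n; m≤m+n; m≤n+m; m≤m*n; m+n∸m≡n; +-suc; suc-injective; *-identityˡ; *-assoc;
         ^-distribˡ-+-*; ^-*-assoc)
open import Data.Nat.Tactic.RingSolver using () renaming (solve-∀ to ℕ-solve-∀)
open import Data.Product using (∃; ∃₂; _,_; proj₁; proj₂)
open import Function using (_∘_)
open import Function.Bundles using (mk⇔)
open import Level using (0ℓ)
open import Relation.Binary.PropositionalEquality
  using (_≡_; _≢_; _≗_; refl; sym; trans; cong; cong₂; subst; module ≡-Reasoning)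
open import Relation.Nullary using (Dec; ¬_)
open import Relation.Nullary.Decidable using (dec-false)

open CommutativeSemigroupProperties
  (CommutativeRing.+-commutativeSemigroup xor-∧-commutativeRing)
  using () renaming (interchange to xor-interchange; x∙yz≈y∙xz to xor-swap)

-- Power series over the field with two elements

Series : Set
Series = ℕ → Bool

tail : Series → Series
tail f = f ∘ suc

0ˢ : Series
0ˢ _ = false

monomial : ℕ → Series
monomial m n = m ≡ᵇ n

infixl 6 _⊕_
_⊕_ : Series → Series → Series
(f ⊕ g) n = f n xor g n

infixl 7 _⊛_
_⊛_ : Series → Series → Series
(f ⊛ g) zero    = f 0 ∧ g 0
(f ⊛ g) (suc n) = (f 0 ∧ g (suc n)) xor (tail f ⊛ g) n

-- Coefficient n of a product sees only coefficients up to n of the factors. This is what allows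
-- theta series to be cut to one finite range inside a product.
⊛-cong-≤ : ∀ {f f′ g g′} n → (∀ {i} → i ≤ n → f i ≡ f′ i) → (∀ {i} → i ≤ n → g i ≡ g′ i) →
           (f ⊛ g) n ≡ (f′ ⊛ g′) n
⊛-cong-≤ zero    p q = cong₂ _∧_ (p z≤n) (q z≤n)
⊛-cong-≤ (suc n) p q = cong₂ _xor_ (cong₂ _∧_ (p z≤n) (q ≤-refl))
                                   (⊛-cong-≤ n (p ∘ s≤s) (q ∘ m≤n⇒m≤1+n))

⊛-cong : ∀ {f f′ g g′} → f ≗ f′ → g ≗ g′ → f ⊛ g ≗ f′ ⊛ g′
⊛-cong p q n = ⊛-cong-≤ n (λ {i} _ → p i) (λ {i} _ → q i)

⊛-zeroˡ : ∀ f → 0ˢ ⊛ f ≗ 0ˢ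
⊛-zeroˡ f zero    = refl
⊛-zeroˡ f (suc n) = ⊛-zeroˡ f n

⊛-identityˡ : ∀ f → monomial 0 ⊛ f ≗ f
⊛-identityˡ f zero    = refl
⊛-identityˡ f (suc n) = trans (cong (f (suc n) xor_) (⊛-zeroˡ f n)) (xor-identityʳ _)

⊛-distribʳ : ∀ h f g → (f ⊕ g) ⊛ h ≗ f ⊛ h ⊕ g ⊛ h
⊛-distribʳ h f g zero    = ∧-distribʳ-xor (h 0) (f 0) (g 0)
⊛-distribʳ h f g (suc n) = trans
  (cong₂ _xor_ (∧-distribʳ-xor (h (suc n)) (f 0) (g 0)) (⊛-distribʳ h (tail f) (tail g) n))
  (xor-interchange (f 0 ∧ h (suc n)) _ _ _)

⊛-scaleˡ : ∀ b f g → (λ n → b ∧ f n) ⊛ g ≗ λ n → b ∧ (f ⊛ g) n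
⊛-scaleˡ b f g zero    = ∧-assoc b (f 0) (g 0)
⊛-scaleˡ b f g (suc n) = trans
  (cong₂ _xor_ (∧-assoc b (f 0) (g (suc n))) (⊛-scaleˡ b (tail f) g n))
  (sym (∧-distribˡ-xor b _ _))

-- The defining recursion splits off the constant term of the left factor. This mirror form splits
-- it off on the right, and commutativity follows by comparing the two.
⊛-sucʳ : ∀ f g n → (f ⊛ g) (suc n) ≡ (f (suc n) ∧ g 0) xor (f ⊛ tail g) n
⊛-sucʳ f g zero    = xor-comm (f 0 ∧ g 1) (f 1 ∧ g 0)
⊛-sucʳ f g (suc n) = trans (cong ((f 0 ∧ g (2 + n)) xor_) (⊛-sucʳ (tail f) g n))
  (xor-swap (f 0 ∧ g (2 + n)) (f (2 + n) ∧ g 0) ((tail f ⊛ tail g) n))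

⊛-comm : ∀ f g → f ⊛ g ≗ g ⊛ f
⊛-comm f g zero    = ∧-comm (f 0) (g 0)
⊛-comm f g (suc n) = trans (cong₂ _xor_ (∧-comm (f 0) (g (suc n))) (⊛-comm (tail f) g n))
  (sym (⊛-sucʳ g f n))

⊛-assoc : ∀ f g h → (f ⊛ g) ⊛ h ≗ f ⊛ (g ⊛ h)
⊛-assoc f g h zero    = ∧-assoc (f 0) (g 0) (h 0)
⊛-assoc f g h (suc n) = begin
  ((f 0 ∧ g 0) ∧ h (suc n)) xor (((λ m → f 0 ∧ g (suc m)) ⊕ tail f ⊛ g) ⊛ h) n
    ≡⟨ cong₂ _xor_ (∧-assoc (f 0) (g 0) (h (suc n)))
         (trans (⊛-distribʳ h _ (tail f ⊛ g) n)
                (cong₂ _xor_ (⊛-scaleˡ (f 0) (tail g) h n) (⊛-assoc (tail f) g h n))) ⟩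
  (f 0 ∧ (g 0 ∧ h (suc n))) xor ((f 0 ∧ (tail g ⊛ h) n) xor (tail f ⊛ (g ⊛ h)) n)
    ≡⟨ sym (xor-assoc (f 0 ∧ (g 0 ∧ h (suc n))) _ _) ⟩
  ((f 0 ∧ (g 0 ∧ h (suc n))) xor (f 0 ∧ (tail g ⊛ h) n)) xor (tail f ⊛ (g ⊛ h)) n
    ≡⟨ cong (_xor (tail f ⊛ (g ⊛ h)) n) (sym (∧-distribˡ-xor (f 0) _ _)) ⟩
  (f 0 ∧ (g ⊛ h) (suc n)) xor (tail f ⊛ (g ⊛ h)) n ∎
  where open ≡-Reasoning

⊛-commutativeMonoid : CommutativeMonoid 0ℓ 0ℓ
⊛-commutativeMonoid = record
  { Carrier = Series ; _≈_ = _≗_ ; _∙_ = _⊛_ ; ε = monomial 0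
  ; isCommutativeMonoid = record
    { isMonoid = record
      { isSemigroup = record
        { isMagma = record
          { isEquivalence = record
            { refl = λ _ → refl ; sym = λ p n → sym (p n) ; trans = λ p q n → trans (p n) (q n) }
          ; ∙-cong = ⊛-cong }
        ; assoc = ⊛-assoc }
      ; identity = ⊛-identityˡ , λ f n → trans (⊛-comm f (monomial 0) n) (⊛-identityˡ f n) }
    ; comm = ⊛-comm } }

-- Sections and the Frobenius map

double : ℕ → ℕ
double zero    = zero
double (suc n) = suc (suc (double n))

even odd : Series → Series
even f n = f (double n)
odd  f n = f (suc (double n))

-- This is f(q²), the Frobenius image of f.
expand : Series → Series
expand f zero          = f 0
expand f (suc zero)    = false
expand f (suc (suc n)) = expand (tail f) n

even-expand : ∀ f → even (expand f) ≗ f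
even-expand f zero    = refl
even-expand f (suc n) = even-expand (tail f) n

odd-expand : ∀ f → odd (expand f) ≗ 0ˢ
odd-expand f zero    = refl
odd-expand f (suc n) = odd-expand (tail f) n

≗-expand : ∀ {f g} → even f ≗ g → odd f ≗ 0ˢ → f ≗ expand g
≗-expand p q zero          = p 0
≗-expand p q (suc zero)    = q 0
≗-expand p q (suc (suc n)) = ≗-expand (p ∘ suc) (q ∘ suc) n

-- Frobenius in characteristic 2: for f = f(0) + q g the cross term f(0) q g occurs twice and
-- cancels, leaving f(0) + q² g².
⊛-square : ∀ f → f ⊛ f ≗ expand f
⊛-square f zero          = ∧-idem (f 0)
⊛-square f (suc zero)    = trans (cong ((f 0 ∧ f 1) xor_) (∧-comm (f 1) (f 0))) (xor-same (f 0 ∧ f 1))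
⊛-square f (suc (suc n)) = begin
  (f 0 ∧ f (2 + n)) xor (tail f ⊛ f) (suc n)
    ≡⟨ cong ((f 0 ∧ f (2 + n)) xor_) (⊛-comm (tail f) f (suc n)) ⟩
  (f 0 ∧ f (2 + n)) xor ((f 0 ∧ f (2 + n)) xor (tail f ⊛ tail f) n)
    ≡⟨ sym (xor-assoc (f 0 ∧ f (2 + n)) _ _) ⟩
  ((f 0 ∧ f (2 + n)) xor (f 0 ∧ f (2 + n))) xor (tail f ⊛ tail f) n
    ≡⟨ cong (_xor (tail f ⊛ tail f) n) (xor-same (f 0 ∧ f (2 + n))) ⟩
  (tail f ⊛ tail f) n
    ≡⟨ ⊛-square (tail f) n ⟩
  expand (tail f) n ∎
  where open ≡-Reasoning

-- A factor in q² does not mix the parities of exponents, so it leaves a section as h(q). The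
-- induction removes two coefficients of f at a time, one of each parity.
even-⊛-expand : ∀ f h → even (f ⊛ expand h) ≗ even f ⊛ h
even-⊛-expand f h zero    = refl
even-⊛-expand f h (suc n) = begin
  (f 0 ∧ expand (tail h) (double n)) xor
    ((f 1 ∧ expand h (suc (double n))) xor (tail (tail f) ⊛ expand h) (double n))
    ≡⟨ cong₂ _xor_ (cong (f 0 ∧_) (even-expand (tail h) n))
         (cong₂ _xor_ (trans (cong (f 1 ∧_) (odd-expand h n)) (∧-zeroʳ (f 1)))
                      (even-⊛-expand (tail (tail f)) h n)) ⟩
  (f 0 ∧ h (suc n)) xor (tail (even f) ⊛ h) n ∎
  where open ≡-Reasoning

odd-⊛-expand : ∀ f h → odd (f ⊛ expand h) ≗ odd f ⊛ h
odd-⊛-expand f h n = cong₂ _xor_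
  (trans (cong (f 0 ∧_) (odd-expand h n)) (∧-zeroʳ (f 0)))
  (even-⊛-expand (tail f) h n)

-- From D = T D² = T D(q²), the first section is S(q²) D = S² D and the second is S³ D. Substituting
-- D = T D² once more gives S T (S D)², whose last factor is a series in q². The odd section
-- therefore acts on S T alone and yields T W S D = W S.
reciprocal-section : ∀ {T D S W} → T ⊛ D ≗ monomial 0 → even T ≗ expand S → odd (S ⊛ T) ≗ T ⊛ W →
                     odd (even (even D)) ≗ W ⊛ S
reciprocal-section {T} {D} {S} {W} TD≗1 evenT oddST n = begin
  even (even D) (suc (double n))
    ≡⟨ even-even-D (suc (double n)) ⟩
  ((S ⊛ T) ⊛ expand (S ⊛ D)) (suc (double n))
    ≡⟨ odd-⊛-expand (S ⊛ T) (S ⊛ D) n ⟩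
  (odd (S ⊛ T) ⊛ (S ⊛ D)) n
    ≡⟨ ⊛-cong oddST (λ _ → refl) n ⟩
  ((T ⊛ W) ⊛ (S ⊛ D)) n
    ≡⟨ solve 4 (λ t w s d → ((t ⊙ w) ⊙ (s ⊙ d)) ⊜ ((t ⊙ d) ⊙ (w ⊙ s))) (λ _ → refl) T W S D n ⟩
  ((T ⊛ D) ⊛ (W ⊛ S)) n
    ≡⟨ ⊛-cong TD≗1 (λ _ → refl) n ⟩
  (monomial 0 ⊛ (W ⊛ S)) n
    ≡⟨ ⊛-identityˡ (W ⊛ S) n ⟩
  (W ⊛ S) n ∎
  where
  open ≡-Reasoning
  open CommutativeMonoidSolver ⊛-commutativeMonoid using (solve; _⊜_) renaming (_⊕_ to _⊙_)

  D≗T⊛D⊛D : D ≗ T ⊛ (D ⊛ D)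
  D≗T⊛D⊛D m = begin
    D m                  ≡⟨ sym (⊛-identityˡ D m) ⟩
    (monomial 0 ⊛ D) m   ≡⟨ ⊛-cong (λ i → sym (TD≗1 i)) (λ _ → refl) m ⟩
    ((T ⊛ D) ⊛ D) m      ≡⟨ ⊛-assoc T D D m ⟩
    (T ⊛ (D ⊛ D)) m      ∎

  even-D : even D ≗ D ⊛ expand S
  even-D m = begin
    even D m                   ≡⟨ D≗T⊛D⊛D (double m) ⟩
    even (T ⊛ (D ⊛ D)) m       ≡⟨ ⊛-cong (λ _ → refl) (⊛-square D) (double m) ⟩
    even (T ⊛ expand D) m      ≡⟨ even-⊛-expand T D m ⟩
    (even T ⊛ D) m             ≡⟨ ⊛-cong evenT (λ _ → refl) m ⟩
    (expand S ⊛ D) m           ≡⟨ ⊛-comm (expand S) D m ⟩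
    (D ⊛ expand S) m           ∎

  even-even-D : even (even D) ≗ (S ⊛ T) ⊛ expand (S ⊛ D)
  even-even-D m = begin
    even (even D) m
      ≡⟨ even-D (double m) ⟩
    even (D ⊛ expand S) m
      ≡⟨ even-⊛-expand D S m ⟩
    (even D ⊛ S) m
      ≡⟨ ⊛-cong (λ i → trans (even-D i) (⊛-cong D≗T⊛D⊛D (λ j → sym (⊛-square S j)) i)) (λ _ → refl) m ⟩
    (((T ⊛ (D ⊛ D)) ⊛ (S ⊛ S)) ⊛ S) m
      ≡⟨ solve 3 (λ t d s → (((t ⊙ (d ⊙ d)) ⊙ (s ⊙ s)) ⊙ s) ⊜ ((s ⊙ t) ⊙ ((s ⊙ d) ⊙ (s ⊙ d))))
           (λ _ → refl) T D S m ⟩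
    ((S ⊛ T) ⊛ ((S ⊛ D) ⊛ (S ⊛ D))) m
      ≡⟨ ⊛-cong (λ _ → refl) (⊛-square (S ⊛ D)) m ⟩
    ((S ⊛ T) ⊛ expand (S ⊛ D)) m ∎

-- Generating functions of finite lists and theta series

-- The n-th coefficient is the parity of the number of list elements of weight n.
coeff : ∀ {A : Set} → (A → ℕ) → List A → Series
coeff e []      = 0ˢ
coeff e (a ∷ L) = monomial (e a) ⊕ coeff e L

module _ {A : Set} where

  coeff-++ : ∀ (e : A → ℕ) L M → coeff e (L ++ M) ≗ coeff e L ⊕ coeff e M
  coeff-++ e []      M n = refl
  coeff-++ e (a ∷ L) M n = trans (cong (monomial (e a) n xor_) (coeff-++ e L M n))
    (sym (xor-assoc (monomial (e a) n) _ _))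

  coeff-map : {B : Set} (e : A → ℕ) (f : B → A) → ∀ L → coeff e (map f L) ≗ coeff (e ∘ f) L
  coeff-map e f []      n = refl
  coeff-map e f (b ∷ L) n = cong (monomial (e (f b)) n xor_) (coeff-map e f L n)

  coeff-vanishes : ∀ (e : A → ℕ) L {n} → (∀ a → e a ≢ n) → coeff e L n ≡ false
  coeff-vanishes e []          p = refl
  coeff-vanishes e (a ∷ L) {n} p = cong₂ _xor_ (dec-false (e a ≟ n) (p a)) (coeff-vanishes e L p)

monomial-⊛ : ∀ m k → monomial m ⊛ monomial k ≗ monomial (m + k)
monomial-⊛ zero    k n       = ⊛-identityˡ (monomial k) n
monomial-⊛ (suc m) k zero    = refl
monomial-⊛ (suc m) k (suc n) = monomial-⊛ m k n

module _ {A B : Set} (e : A → ℕ) (e′ : B → ℕ) where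

  weight-× : A × B → ℕ
  weight-× (a , b) = e a + e′ b

  monomial-⊛-coeff : ∀ m M → monomial m ⊛ coeff e′ M ≗ coeff (λ b → m + e′ b) M
  monomial-⊛-coeff m []      n = trans (⊛-comm (monomial m) 0ˢ n) (⊛-zeroˡ (monomial m) n)
  monomial-⊛-coeff m (b ∷ M) n = begin
    (monomial m ⊛ (monomial (e′ b) ⊕ coeff e′ M)) n
      ≡⟨ ⊛-comm (monomial m) _ n ⟩
    ((monomial (e′ b) ⊕ coeff e′ M) ⊛ monomial m) n
      ≡⟨ ⊛-distribʳ (monomial m) (monomial (e′ b)) (coeff e′ M) n ⟩
    (monomial (e′ b) ⊛ monomial m) n xor (coeff e′ M ⊛ monomial m) n
      ≡⟨ cong₂ _xor_ (trans (⊛-comm (monomial (e′ b)) (monomial m) n) (monomial-⊛ m (e′ b) n))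
                     (trans (⊛-comm (coeff e′ M) (monomial m) n) (monomial-⊛-coeff m M n)) ⟩
    monomial (m + e′ b) n xor coeff (λ b → m + e′ b) M n ∎
    where open ≡-Reasoning

  coeff-⊛ : ∀ L M → coeff e L ⊛ coeff e′ M ≗ coeff weight-× (cartesianProduct L M)
  coeff-⊛ []      M n = ⊛-zeroˡ (coeff e′ M) n
  coeff-⊛ (a ∷ L) M n = begin
    ((monomial (e a) ⊕ coeff e L) ⊛ coeff e′ M) n
      ≡⟨ ⊛-distribʳ (coeff e′ M) (monomial (e a)) (coeff e L) n ⟩
    (monomial (e a) ⊛ coeff e′ M) n xor (coeff e L ⊛ coeff e′ M) n
      ≡⟨ cong₂ _xor_ (trans (monomial-⊛-coeff (e a) M n) (sym (coeff-map weight-× (a ,_) M n)))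
                     (coeff-⊛ L M n) ⟩
    coeff weight-× (map (a ,_) M) n xor coeff weight-× (cartesianProduct L M) n
      ≡⟨ sym (coeff-++ weight-× (map (a ,_) M) (cartesianProduct L M) n) ⟩
    coeff weight-× (cartesianProduct (a ∷ L) M) n ∎
    where open ≡-Reasoning

-- Parity of counts and weight-respecting bijections

isOdd : ℕ → Bool
isOdd zero    = false
isOdd (suc n) = not (isOdd n)

module _ {A : Set} where

  coeff≡isOdd-count : ∀ (e : A → ℕ) L n → coeff e L n ≡ isOdd (length (filter (λ a → e a ≟ n) L))
  coeff≡isOdd-count e []      n = refl
  coeff≡isOdd-count e (a ∷ L) n with e a ≡ᵇ n
  ... | true  = cong not (coeff≡isOdd-count e L n)
  ... | false = coeff≡isOdd-count e L n

  -- Only weight `n` has to be represented completely; elements of other weights may be present or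
  -- missing, as the filter discards them.
  record Exhausts (e : A → ℕ) (n : ℕ) (L : List A) : Set where
    field
      unique   : Unique L
      complete : ∀ a → e a ≡ n → a ∈ L

open Exhausts

-- Filtered by weight, `L` and the image of `M` are duplicate-free with the same members. Hence they
-- are permutations of each other, and their lengths have the same parity.
coeff-bijection : ∀ {A B : Set} {e : A → ℕ} {e′ : B → ℕ} {n m L M} →
                  Exhausts e n L → Exhausts e′ m M → (φ : B → A) → (∀ {x y} → φ x ≡ φ y → x ≡ y) →
                  (∀ b → e′ b ≡ m → e (φ b) ≡ n) → (∀ a → e a ≡ n → ∃ λ b → e′ b ≡ m × a ≡ φ b) →
                  coeff e L n ≡ coeff e′ M m
coeff-bijection {A} {B} {e} {e′} {n} {m} {L} {M} exL exM φ φ-inj to from = begin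
  coeff e L n                 ≡⟨ coeff≡isOdd-count e L n ⟩
  isOdd (length L′)           ≡⟨ cong isOdd (↭-length (∼bag⇒↭ (unique∧set⇒bag uniqueˡ uniqueʳ (mk⇔ ⊆ ⊇)))) ⟩
  isOdd (length (map φ M′))   ≡⟨ cong isOdd (length-map φ M′) ⟩
  isOdd (length M′)           ≡⟨ sym (coeff≡isOdd-count e′ M m) ⟩
  coeff e′ M m                ∎
  where
  open ≡-Reasoning
  e≟n : ∀ a → Dec (e a ≡ n)
  e≟n a = e a ≟ n
  e′≟m : ∀ b → Dec (e′ b ≡ m)
  e′≟m b = e′ b ≟ m
  L′ = filter e≟n L
  M′ = filter e′≟m M
  uniqueˡ : Unique L′
  uniqueˡ = Unique.filter⁺ e≟n (unique exL)
  uniqueʳ : Unique (map φ M′)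
  uniqueʳ = Unique.map⁺ φ-inj (Unique.filter⁺ e′≟m (unique exM))
  ⊆ : ∀ {a} → a ∈ L′ → a ∈ map φ M′
  ⊆ {a} a∈ with from a (proj₂ (∈-filter⁻ e≟n {xs = L} a∈))
  ... | b , eb , refl = ∈-map⁺ φ (∈-filter⁺ e′≟m (complete exM b eb) eb)
  ⊇ : ∀ {a} → a ∈ map φ M′ → a ∈ L′
  ⊇ a∈ with ∈-map⁻ φ a∈
  ... | b , b∈ , refl = ∈-filter⁺ e≟n (complete exL (φ b) eφb) eφb
    where eφb = to b (proj₂ (∈-filter⁻ e′≟m {xs = M} b∈))

-- Theta series indexed by the integers

box : ℕ → List ℤ
box n = map +_ (upTo (suc n)) ++ map -[1+_] (upTo (suc n))

box-unique : ∀ n → Unique (box n)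
box-unique n = Unique.++⁺ (Unique.map⁺ +-injective (Unique.upTo⁺ (suc n)))
                          (Unique.map⁺ -[1+-injective (Unique.upTo⁺ (suc n))) disjoint
  where
  disjoint : ∀ {k} → k ∈ map +_ (upTo (suc n)) × k ∈ map -[1+_] (upTo (suc n)) → ⊥
  disjoint (p , q) with ∈-map⁻ +_ p | ∈-map⁻ -[1+_] q
  ... | _ , _ , refl | _ , _ , ()

∈-box : ∀ {n} k → ∣ k ∣ ≤ n → k ∈ box n
∈-box     (+ i)    i≤n = ∈-++⁺ˡ (∈-map⁺ +_ (∈-upTo⁺ (s≤s i≤n)))
∈-box {n} -[1+ i ] i<n = ∈-++⁺ʳ (map +_ (upTo (suc n))) (∈-map⁺ -[1+_] (∈-upTo⁺ (m≤n⇒m≤1+n i<n)))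

Growing : (ℤ → ℕ) → Set
Growing e = ∀ k → ∣ k ∣ ≤ e k

-- The series Σ q^(e k) over k ∈ ℤ. If `e` is `Growing`, every k that contributes to coefficient n
-- lies in `box n`, so a finite range depending on n suffices.
θ : (ℤ → ℕ) → Series
θ e n = coeff e (box n) n

box-exhausts : ∀ {e n N} → Growing e → n ≤ N → Exhausts e n (box N)
box-exhausts {N = N} g n≤N .unique          = box-unique N
box-exhausts         g n≤N .complete k refl = ∈-box k (≤-trans (g k) n≤N)

θ-truncate : ∀ {e n N} → Growing e → n ≤ N → θ e n ≡ coeff e (box N) n
θ-truncate g n≤N = coeff-bijection (box-exhausts g ≤-refl) (box-exhausts g n≤N) (λ k → k) (λ p → p)
  (λ _ p → p) (λ k p → k , p , refl)

module _ {e e′ : ℤ → ℕ} (g : Growing e) (g′ : Growing e′) where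

  box² : ℕ → List (ℤ × ℤ)
  box² n = cartesianProduct (box n) (box n)

  -- Different coefficients of a theta series use different boxes. Truncation moves all those up to
  -- n to the common `box n`, where the product becomes a sum over pairs.
  θ-⊛ : ∀ n → (θ e ⊛ θ e′) n ≡ coeff (weight-× e e′) (box² n) n
  θ-⊛ n = trans (⊛-cong-≤ n (θ-truncate g) (θ-truncate g′)) (coeff-⊛ e e′ (box n) (box n) n)

  box²-exhausts : ∀ n → Exhausts (weight-× e e′) n (box² n)
  box²-exhausts n .unique = Unique.cartesianProduct⁺ (box-unique n) (box-unique n)
  box²-exhausts n .complete (k , l) refl = ∈-cartesianProduct⁺
    (∈-box k (≤-trans (g k) (m≤m+n (e k) (e′ l))))
    (∈-box l (≤-trans (g′ l) (m≤n+m (e′ l) (e k))))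

-- Parity of integers

isOdd-+ : ∀ m n → isOdd (m + n) ≡ isOdd m xor isOdd n
isOdd-+ zero    n = refl
isOdd-+ (suc m) n = trans (cong not (isOdd-+ m n)) (not-distribˡ-xor (isOdd m) (isOdd n))

isOdd-* : ∀ m n → isOdd (m * n) ≡ isOdd m ∧ isOdd n
isOdd-* zero    n = refl
isOdd-* (suc m) n = trans (isOdd-+ n (m * n))
  (trans (cong (isOdd n xor_) (isOdd-* m n)) (lemma (isOdd m) (isOdd n)))
  where
  lemma : ∀ a b → b xor (a ∧ b) ≡ not a ∧ b
  lemma false b     = xor-identityʳ b
  lemma true  b     = xor-same b

¬isOdd⇒2∣ : ∀ n → isOdd n ≡ false → 2 ∣ℕ n
¬isOdd⇒2∣ zero          _ = 2 ∣0
¬isOdd⇒2∣ (suc (suc n)) p = ∣m∣n⇒∣m+n ∣-refl (¬isOdd⇒2∣ n (trans (sym (not-involutive (isOdd n))) p))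

parity : ℤ → Bool
parity k = isOdd ∣ k ∣

parity-⊖ : ∀ m n → parity (m ⊖ n) ≡ isOdd m xor isOdd n
parity-⊖ zero    zero    = refl
parity-⊖ zero    (suc n) = refl
parity-⊖ (suc m) zero    = sym (xor-identityʳ _)
parity-⊖ (suc m) (suc n) = trans (cong parity ([1+m]⊖[1+n]≡m⊖n m n))
  (trans (parity-⊖ m n) (sym (xor-annihilates-not (isOdd m) (isOdd n))))

parity-+ : ∀ i j → parity (i ℤ.+ j) ≡ parity i xor parity j
parity-+ (+ m)      (+ n)      = isOdd-+ m n
parity-+ (+ m)      -[1+ n ]   = parity-⊖ m (suc n)
parity-+ -[1+ m ]   (+ n)      = trans (parity-⊖ n (suc m)) (xor-comm (isOdd n) _)
parity-+ -[1+ m ]   -[1+ n ]   = trans (cong isOdd (sym (cong suc (+-suc m n)))) (isOdd-+ (suc m) (suc n))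

parity-* : ∀ i j → parity (i ℤ.* j) ≡ parity i ∧ parity j
parity-* i j = trans (cong isOdd (abs-* i j)) (isOdd-* ∣ i ∣ ∣ j ∣)

parity-neg : ∀ i → parity (ℤ.- i) ≡ parity i
parity-neg i = cong isOdd (∣-i∣≡∣i∣ i)

double≢1+double : ∀ i j → + 2 ℤ.* i ≢ + 1 ℤ.+ + 2 ℤ.* j
double≢1+double i j eq with trans (sym (parity-* (+ 2) i)) (trans (cong parity eq)
  (trans (parity-+ (+ 1) (+ 2 ℤ.* j)) (cong not (parity-* (+ 2) j))))
... | ()

data Half : ℤ → Set where
  evenly : ∀ j → Half (+ 2 ℤ.* j)
  oddly  : ∀ j → Half (+ 1 ℤ.+ + 2 ℤ.* j)

half-ℕ : ∀ n → Half (+ n)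
half-ℕ zero    = evenly (+ 0)
half-ℕ (suc n) = step (half-ℕ n)
  where
  step : ∀ {k} → Half k → Half (+ 1 ℤ.+ k)
  step (evenly j) = oddly j
  step (oddly j)  = subst Half (lemma j) (evenly (+ 1 ℤ.+ j))
    where
    lemma : ∀ j → + 2 ℤ.* (+ 1 ℤ.+ j) ≡ + 1 ℤ.+ (+ 1 ℤ.+ + 2 ℤ.* j)
    lemma = ℤ-solve-∀

half : ∀ k → Half k
half (+ n)    = half-ℕ n
half -[1+ n ] = negate (half-ℕ (suc n))
  where
  negate : ∀ {k} → Half k → Half (ℤ.- k)
  negate (evenly j) = subst Half (lemma j) (evenly (ℤ.- j))
    where
    lemma : ∀ j → + 2 ℤ.* (ℤ.- j) ≡ ℤ.- (+ 2 ℤ.* j)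
    lemma = ℤ-solve-∀
  negate (oddly j)  = subst Half (lemma j) (oddly (ℤ.- j ℤ.- + 1))
    where
    lemma : ∀ j → + 1 ℤ.+ + 2 ℤ.* (ℤ.- j ℤ.- + 1) ≡ ℤ.- (+ 1 ℤ.+ + 2 ℤ.* j)
    lemma = ℤ-solve-∀

+-double : ∀ n → + double n ≡ + 2 ℤ.* + n
+-double zero    = refl
+-double (suc n) = trans (cong (λ k → + 2 ℤ.+ k) (+-double n)) (lemma (+ n))
  where
  lemma : ∀ k → + 2 ℤ.+ + 2 ℤ.* k ≡ + 2 ℤ.* (+ 1 ℤ.+ k)
  lemma = ℤ-solve-∀

+-1+double : ∀ n → + suc (double n) ≡ + 1 ℤ.+ + 2 ℤ.* + n
+-1+double n = cong (λ k → + 1 ℤ.+ k) (+-double n)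

double-injective : ∀ {m n} → double m ≡ double n → m ≡ n
double-injective {m} {n} eq = +-injective (*-cancelˡ-≡ (+ 2) _ _
  (trans (sym (+-double m)) (trans (cong +_ eq) (+-double n))))

-- Sums of two squares

SumOfTwoSquares : ℤ → Set
SumOfTwoSquares m = ∃₂ λ x y → x ℤ.* x ℤ.+ y ℤ.* y ≡ m

-- If x + y = 2p, then x² + y² = 2 (p² + (p − y)²).
sumOfTwoSquares-halve : ∀ m → SumOfTwoSquares (+ 2 ℤ.* m) → SumOfTwoSquares m
sumOfTwoSquares-halve m (x , y , eq) = go (half (x ℤ.+ y)) refl
  where
  x≡ : ∀ {s} → x ℤ.+ y ≡ s → x ≡ s ℤ.- y
  x≡ refl = lemma x y
    where
    lemma : ∀ x y → x ≡ x ℤ.+ y ℤ.- y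
    lemma = ℤ-solve-∀
  eq′ : ∀ {s} → x ℤ.+ y ≡ s → (s ℤ.- y) ℤ.* (s ℤ.- y) ℤ.+ y ℤ.* y ≡ + 2 ℤ.* m
  eq′ p = trans (cong (λ z → z ℤ.* z ℤ.+ y ℤ.* y) (sym (x≡ p))) eq
  go : ∀ {s} → Half s → x ℤ.+ y ≡ s → SumOfTwoSquares m
  go (evenly p) q = p , p ℤ.- y , *-cancelˡ-≡ (+ 2) _ _ (trans (lemma p y) (eq′ q))
    where
    lemma : ∀ p y → + 2 ℤ.* (p ℤ.* p ℤ.+ (p ℤ.- y) ℤ.* (p ℤ.- y))
                  ≡ (+ 2 ℤ.* p ℤ.- y) ℤ.* (+ 2 ℤ.* p ℤ.- y) ℤ.+ y ℤ.* y
    lemma = ℤ-solve-∀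
  -- If x + y = 1 + 2p, then x² + y² is odd; the expression below is (x² + y² - 1) / 2 after
  -- eliminating x.
  go (oddly p)  q = ⊥-elim (double≢1+double m
    (+ 2 ℤ.* p ℤ.* p ℤ.+ + 2 ℤ.* p ℤ.- + 2 ℤ.* p ℤ.* y ℤ.- y ℤ.+ y ℤ.* y)
    (trans (sym (eq′ q)) (lemma p y)))
    where
    lemma : ∀ p y → (+ 1 ℤ.+ + 2 ℤ.* p ℤ.- y) ℤ.* (+ 1 ℤ.+ + 2 ℤ.* p ℤ.- y) ℤ.+ y ℤ.* y
                  ≡ + 1 ℤ.+ + 2 ℤ.* (+ 2 ℤ.* p ℤ.* p ℤ.+ + 2 ℤ.* p ℤ.- + 2 ℤ.* p ℤ.* y ℤ.- y ℤ.+ y ℤ.* y)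
    lemma = ℤ-solve-∀

-- Squares are 0 or 1 modulo 4: equal parities of x and y give an even sum, and different parities
-- give 1 modulo 4.
3+4t-notSumOfTwoSquares : ∀ t → ¬ SumOfTwoSquares (+ 3 ℤ.+ + 4 ℤ.* t)
3+4t-notSumOfTwoSquares t (x , y , eq) = go (half x) (half y) eq
  where
  3+4t-odd : ∀ t → + 3 ℤ.+ + 4 ℤ.* t ≡ + 1 ℤ.+ + 2 ℤ.* (+ 1 ℤ.+ + 2 ℤ.* t)
  3+4t-odd = ℤ-solve-∀
  not-1+4j : ∀ j → + 1 ℤ.+ + 4 ℤ.* j ≢ + 3 ℤ.+ + 4 ℤ.* t
  not-1+4j j p = double≢1+double j t (*-cancelˡ-≡ (+ 2) _ _ (trans (l₁ j) (trans (cong (ℤ._- + 1) p) (l₂ t))))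
    where
    l₁ : ∀ j → + 2 ℤ.* (+ 2 ℤ.* j) ≡ + 1 ℤ.+ + 4 ℤ.* j ℤ.- + 1
    l₁ = ℤ-solve-∀
    l₂ : ∀ t → + 3 ℤ.+ + 4 ℤ.* t ℤ.- + 1 ≡ + 2 ℤ.* (+ 1 ℤ.+ + 2 ℤ.* t)
    l₂ = ℤ-solve-∀
  go : ∀ {x y} → Half x → Half y → x ℤ.* x ℤ.+ y ℤ.* y ≢ + 3 ℤ.+ + 4 ℤ.* t
  go (evenly i) (evenly j) p = double≢1+double (+ 2 ℤ.* i ℤ.* i ℤ.+ + 2 ℤ.* j ℤ.* j) (+ 1 ℤ.+ + 2 ℤ.* t)
    (trans (lemma i j) (trans p (3+4t-odd t)))
    where
    lemma : ∀ i j → + 2 ℤ.* (+ 2 ℤ.* i ℤ.* i ℤ.+ + 2 ℤ.* j ℤ.* j)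
                  ≡ (+ 2 ℤ.* i) ℤ.* (+ 2 ℤ.* i) ℤ.+ (+ 2 ℤ.* j) ℤ.* (+ 2 ℤ.* j)
    lemma = ℤ-solve-∀
  go (evenly i) (oddly j)  p = not-1+4j (i ℤ.* i ℤ.+ j ℤ.+ j ℤ.* j) (trans (lemma i j) p)
    where
    lemma : ∀ i j → + 1 ℤ.+ + 4 ℤ.* (i ℤ.* i ℤ.+ j ℤ.+ j ℤ.* j)
                  ≡ (+ 2 ℤ.* i) ℤ.* (+ 2 ℤ.* i) ℤ.+ (+ 1 ℤ.+ + 2 ℤ.* j) ℤ.* (+ 1 ℤ.+ + 2 ℤ.* j)
    lemma = ℤ-solve-∀
  go (oddly i)  (evenly j) p = go (evenly j) (oddly i)
    (trans (ℤ.+-comm _ ((+ 1 ℤ.+ + 2 ℤ.* i) ℤ.* (+ 1 ℤ.+ + 2 ℤ.* i))) p)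
  go (oddly i)  (oddly j)  p = double≢1+double
    (+ 1 ℤ.+ + 2 ℤ.* (i ℤ.+ i ℤ.* i ℤ.+ j ℤ.+ j ℤ.* j)) (+ 1 ℤ.+ + 2 ℤ.* t)
    (trans (lemma i j) (trans p (3+4t-odd t)))
    where
    lemma : ∀ i j → + 2 ℤ.* (+ 1 ℤ.+ + 2 ℤ.* (i ℤ.+ i ℤ.* i ℤ.+ j ℤ.+ j ℤ.* j))
                  ≡ (+ 1 ℤ.+ + 2 ℤ.* i) ℤ.* (+ 1 ℤ.+ + 2 ℤ.* i) ℤ.+ (+ 1 ℤ.+ + 2 ℤ.* j) ℤ.* (+ 1 ℤ.+ + 2 ℤ.* j)
    lemma = ℤ-solve-∀

-- Descent: each halving of a representation strips one factor 2, down to the case 3 modulo 4.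
2^b[3+4t]-notSumOfTwoSquares : ∀ b t → ¬ SumOfTwoSquares (+ (2 ^ b * (3 + 4 * t)))
2^b[3+4t]-notSumOfTwoSquares zero    t s = 3+4t-notSumOfTwoSquares (+ t)
  (subst SumOfTwoSquares (trans (cong +_ (*-identityˡ (3 + 4 * t))) (cong (λ k → + 3 ℤ.+ k) (pos-* 4 t))) s)
2^b[3+4t]-notSumOfTwoSquares (suc b) t s = 2^b[3+4t]-notSumOfTwoSquares b t
  (sumOfTwoSquares-halve _ (subst SumOfTwoSquares
    (trans (cong +_ (*-assoc 2 (2 ^ b) (3 + 4 * t))) (pos-* 2 (2 ^ b * (3 + 4 * t)))) s))

-- Theta identities

-- The polynomial (p + q)k² + pk. Negative k is expanded separately, with p and q changing roles, so
-- that no subtraction of naturals occurs.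
quad : ℕ → ℕ → ℤ → ℕ
quad p q (+ n)      = n * ((p + q) * n + p)
quad p q -[1+ n ]   = suc n * (q + (p + q) * n)

quad-ℤ : ∀ p q k → + quad p q k ≡ k ℤ.* (+ (p + q) ℤ.* k ℤ.+ + p)
quad-ℤ p q (+ n) = trans (pos-* n ((p + q) * n + p))
  (cong (λ x → + n ℤ.* (x ℤ.+ + p)) (pos-* (p + q) n))
quad-ℤ p q -[1+ n ] = trans (pos-* (suc n) (q + (p + q) * n))
  (trans (cong (λ x → + suc n ℤ.* (+ q ℤ.+ x)) (pos-* (p + q) n)) (lemma (+ n) (+ p) (+ q)))
  where
  lemma : ∀ n p q → (+ 1 ℤ.+ n) ℤ.* (q ℤ.+ (p ℤ.+ q) ℤ.* n)
        ≡ (ℤ.- (+ 1 ℤ.+ n)) ℤ.* ((p ℤ.+ q) ℤ.* (ℤ.- (+ 1 ℤ.+ n)) ℤ.+ p)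
  lemma = ℤ-solve-∀

quad-growing : ∀ p q → Growing (quad (suc p) (suc q))
quad-growing p q (+ zero)    = z≤n
quad-growing p q (+ suc n)   = m≤m*n (suc n) _
quad-growing p q -[1+ n ]    = m≤m*n (suc n) (suc q + (suc p + suc q) * n)

-- Completing squares: 7s + 1 = (7k + 1)², 7t + 4 = (7k + 2)² and 7w + 2 = (7k + 3)². The `suc` in
-- `w` is the factor q of `W`.
s t w : ℤ → ℕ
s = quad 2 5
t = quad 4 3
w = suc ∘ quad 6 1

S T W : Series
S = θ s
T = θ t
W = θ w

s-growing : Growing s
s-growing = quad-growing 1 4

t-growing : Growing t
t-growing = quad-growing 3 2

w-growing : Growing w
w-growing k = m≤n⇒m≤1+n (quad-growing 5 0 k)

t-double : ∀ j → + t (+ 2 ℤ.* j) ≡ + 2 ℤ.* (+ 2 ℤ.* + s j)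
t-double j = trans (quad-ℤ 4 3 (+ 2 ℤ.* j))
  (trans (lemma j) (cong (λ x → + 2 ℤ.* (+ 2 ℤ.* x)) (sym (quad-ℤ 2 5 j))))
  where
  lemma : ∀ j → + 2 ℤ.* j ℤ.* (+ 7 ℤ.* (+ 2 ℤ.* j) ℤ.+ + 4)
              ≡ + 2 ℤ.* (+ 2 ℤ.* (j ℤ.* (+ 7 ℤ.* j ℤ.+ + 2)))
  lemma = ℤ-solve-∀

t-1+double : ∀ j → ∃ λ i → + t (+ 1 ℤ.+ + 2 ℤ.* j) ≡ + 1 ℤ.+ + 2 ℤ.* i
t-1+double j = + 14 ℤ.* j ℤ.* j ℤ.+ + 18 ℤ.* j ℤ.+ + 5 , trans (quad-ℤ 4 3 (+ 1 ℤ.+ + 2 ℤ.* j)) (lemma j)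
  where
  lemma : ∀ j → (+ 1 ℤ.+ + 2 ℤ.* j) ℤ.* (+ 7 ℤ.* (+ 1 ℤ.+ + 2 ℤ.* j) ℤ.+ + 4)
              ≡ + 1 ℤ.+ + 2 ℤ.* (+ 14 ℤ.* j ℤ.* j ℤ.+ + 18 ℤ.* j ℤ.+ + 5)
  lemma = ℤ-solve-∀

t-1+double-odd : ∀ j n → t (+ 1 ℤ.+ + 2 ℤ.* j) ≢ double n
t-1+double-odd j n eq with i , t≡ ← t-1+double j =
  double≢1+double (+ n) i (trans (sym (+-double n)) (trans (sym (cong +_ eq)) t≡))

+-double² : ∀ n → + double (double n) ≡ + 2 ℤ.* (+ 2 ℤ.* + n)
+-double² n = trans (+-double (double n)) (cong (λ x → + 2 ℤ.* x) (+-double n))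

-- The exponent 7k² + 4k has the parity of k, and k = 2j turns it into 4(7j² + 2j). So the even
-- exponents are all multiples of 4, and the quarters are the exponents of `S`.
even-T : even T ≗ expand S
even-T = ≗-expand even-even-T odd-even-T
  where
  even-even-T : even (even T) ≗ S
  even-even-T n = coeff-bijection (box-exhausts t-growing ≤-refl) (box-exhausts s-growing ≤-refl)
    (λ j → + 2 ℤ.* j) (*-cancelˡ-≡ (+ 2) _ _) to (λ k → from (half k))
    where
    to : ∀ j → s j ≡ n → t (+ 2 ℤ.* j) ≡ double (double n)
    to j refl = +-injective (trans (t-double j) (sym (+-double² (s j))))
    from : ∀ {k} → Half k → t k ≡ double (double n) → ∃ λ j → s j ≡ n × k ≡ + 2 ℤ.* j
    from (evenly j) eq = j , +-injective (*-cancelˡ-≡ (+ 2) _ _ (*-cancelˡ-≡ (+ 2) _ _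
      (trans (sym (t-double j)) (trans (cong +_ eq) (+-double² n))))) , refl
    from (oddly j) eq = ⊥-elim (t-1+double-odd j (double n) eq)
  odd-even-T : odd (even T) ≗ 0ˢ
  odd-even-T n = coeff-vanishes t (box N) (λ k → go {k} (half k))
    where
    N = double (suc (double n))
    go : ∀ {k} → Half k → t k ≢ N
    -- After cancelling 2, the equation 4 s(j) = 2(1 + 2n) equates an even and an odd number.
    go (evenly j) eq = double≢1+double (+ s j) (+ n) (*-cancelˡ-≡ (+ 2) _ _
      (trans (sym (t-double j)) (trans (cong +_ eq) (trans (+-double (suc (double n)))
        (cong (λ x → + 2 ℤ.* (+ 1 ℤ.+ x)) (+-double n))))))
    go (oddly j)  eq = t-1+double-odd j (suc (double n)) eq

-- With x = 7k + 1 and z = 7l + 2, the exponents of S T are governed by x² + z², which for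
-- k + l odd is 2 (((x + z) / 2)² + ((x − z) / 2)²); the halves are −(7u + 2) and 7v + 3.
rotate : ℤ × ℤ → ℤ × ℤ
rotate (u , v) = v ℤ.- u , ℤ.- (+ 1 ℤ.+ (u ℤ.+ v))

rotate-injective : ∀ {x y} → rotate x ≡ rotate y → x ≡ y
rotate-injective {u , v} {u′ , v′} eq = cong₂ _,_ u≡u′ v≡v′
  where
  -- The difference of the two coordinates of `rotate (u , v)` is 2v + 1; knowing v, the first
  -- coordinate gives u.
  v-from : ∀ u v → + 2 ℤ.* v ≡ (v ℤ.- u) ℤ.- ℤ.- (+ 1 ℤ.+ (u ℤ.+ v)) ℤ.- + 1
  v-from = ℤ-solve-∀
  u-from : ∀ u v → u ≡ v ℤ.- (v ℤ.- u)
  u-from = ℤ-solve-∀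
  v≡v′ : v ≡ v′
  v≡v′ = *-cancelˡ-≡ (+ 2) v v′ (trans (v-from u v)
    (trans (cong (λ x → proj₁ x ℤ.- proj₂ x ℤ.- + 1) eq) (sym (v-from u′ v′))))
  u≡u′ : u ≡ u′
  u≡u′ = trans (u-from u v) (trans (cong₂ ℤ._-_ v≡v′ (cong proj₁ eq)) (sym (u-from u′ v′)))

-- In completed squares, 7(s + t) + 5 = x² + z² is twice (7u + 2)² + (7v + 3)² = 7(t + w) + 6;
-- solving for s + t gives 2(t + w) + 1.
weight-rotate : ∀ x → weight-× s t (rotate x) ≡ suc (double (weight-× t w x))
weight-rotate (u , v) = +-injective (trans
  (cong₂ ℤ._+_ (quad-ℤ 2 5 (v ℤ.- u)) (quad-ℤ 4 3 (ℤ.- (+ 1 ℤ.+ (u ℤ.+ v)))))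
  (trans (lemma u v)
    (trans (cong₂ (λ x y → + 1 ℤ.+ + 2 ℤ.* (x ℤ.+ (+ 1 ℤ.+ y))) (sym (quad-ℤ 4 3 u)) (sym (quad-ℤ 6 1 v)))
    (sym (+-1+double (weight-× t w (u , v)))))))
  where
  lemma : ∀ u v →
    (v ℤ.- u) ℤ.* (+ 7 ℤ.* (v ℤ.- u) ℤ.+ + 2)
      ℤ.+ (ℤ.- (+ 1 ℤ.+ (u ℤ.+ v))) ℤ.* (+ 7 ℤ.* (ℤ.- (+ 1 ℤ.+ (u ℤ.+ v))) ℤ.+ + 4)
    ≡ + 1 ℤ.+ + 2 ℤ.* (u ℤ.* (+ 7 ℤ.* u ℤ.+ + 4) ℤ.+ (+ 1 ℤ.+ v ℤ.* (+ 7 ℤ.* v ℤ.+ + 6)))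
  lemma = ℤ-solve-∀

-- The exponent s(k) + t(l) has the parity of k + l, and the pairs with k + l odd are exactly the
-- image of `rotate`. So `rotate` matches the terms of the two sides.
odd-ST : odd (S ⊛ T) ≗ T ⊛ W
odd-ST n = begin
  (S ⊛ T) N
    ≡⟨ θ-⊛ s-growing t-growing N ⟩
  coeff (weight-× s t) (box² s-growing t-growing N) N
    ≡⟨ coeff-bijection (box²-exhausts s-growing t-growing N) (box²-exhausts t-growing w-growing n)
         rotate rotate-injective to (λ { (k , l) → from k l (half (k ℤ.+ l)) refl }) ⟩
  coeff (weight-× t w) (box² t-growing w-growing n) n
    ≡⟨ sym (θ-⊛ t-growing w-growing n) ⟩
  (T ⊛ W) n ∎
  where
  open ≡-Reasoning
  N = suc (double n)
  to : ∀ x → weight-× t w x ≡ n → weight-× s t (rotate x) ≡ N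
  to x eq = trans (weight-rotate x) (cong (suc ∘ double) eq)
  difference : ∀ k l → l ≡ k ℤ.+ l ℤ.- k
  difference = ℤ-solve-∀
  from : ∀ k l {j} → Half j → k ℤ.+ l ≡ j → weight-× s t (k , l) ≡ N →
         ∃ λ x → weight-× t w x ≡ n × (k , l) ≡ rotate x
  from k l (evenly j) k+l eq = ⊥-elim (double≢1+double _ (+ n) (trans (lemma k j)
    (trans (cong (λ l → k ℤ.* (+ 7 ℤ.* k ℤ.+ + 2) ℤ.+ l ℤ.* (+ 7 ℤ.* l ℤ.+ + 4)) (sym l≡))
      (trans (sym (cong₂ ℤ._+_ (quad-ℤ 2 5 k) (quad-ℤ 4 3 l))) (trans (cong +_ eq) (+-1+double n))))))
    where
    l≡ : l ≡ + 2 ℤ.* j ℤ.- k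
    l≡ = trans (difference k l) (cong (ℤ._- k) k+l)
    lemma : ∀ k j →
      + 2 ℤ.* (+ 7 ℤ.* k ℤ.* k ℤ.- k ℤ.+ + 14 ℤ.* j ℤ.* j ℤ.- + 14 ℤ.* j ℤ.* k ℤ.+ + 4 ℤ.* j)
      ≡ k ℤ.* (+ 7 ℤ.* k ℤ.+ + 2) ℤ.+ (+ 2 ℤ.* j ℤ.- k) ℤ.* (+ 7 ℤ.* (+ 2 ℤ.* j ℤ.- k) ℤ.+ + 4)
    lemma = ℤ-solve-∀
  from k l (oddly j) k+l eq = x , double-injective (suc-injective
      (trans (sym (weight-rotate x)) (trans (cong (weight-× s t) (sym kl≡)) eq))) , kl≡
    where
    -- Inverting `rotate`: its coordinates add up to -1 - 2u, so k + l = 1 + 2j forces u = -(1 + j),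
    -- and then v = k + u.
    x = ℤ.- (+ 1 ℤ.+ j) , k ℤ.- (+ 1 ℤ.+ j)
    first : ∀ k j → k ≡ k ℤ.- (+ 1 ℤ.+ j) ℤ.- ℤ.- (+ 1 ℤ.+ j)
    first = ℤ-solve-∀
    second : ∀ k j → + 1 ℤ.+ + 2 ℤ.* j ℤ.- k ≡ ℤ.- (+ 1 ℤ.+ (ℤ.- (+ 1 ℤ.+ j) ℤ.+ (k ℤ.- (+ 1 ℤ.+ j))))
    second = ℤ-solve-∀
    kl≡ : (k , l) ≡ rotate x
    kl≡ = cong₂ _,_ (first k j) (trans (difference k l) (trans (cong (ℤ._- k) k+l) (second k j)))

-- Each contributing pair (b , a) would give 7n + 3 = (7a + 1)² + (7b + 3)², so here the sum is
-- empty and no cancellation is involved.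
WS-vanishes : ∀ n → ¬ SumOfTwoSquares (+ (7 * n + 3)) → (W ⊛ S) n ≡ false
WS-vanishes n ¬□ = trans (θ-⊛ w-growing s-growing n)
  (coeff-vanishes (weight-× w s) (box² w-growing s-growing n) {n} (λ { (b , a) eq → ¬□
    (+ 7 ℤ.* a ℤ.+ + 1 , + 7 ℤ.* b ℤ.+ + 3 , trans (lemma a b)
      (trans (cong₂ (λ x y → + 7 ℤ.* (+ 1 ℤ.+ y ℤ.+ x) ℤ.+ + 3) (sym (quad-ℤ 2 5 a)) (sym (quad-ℤ 6 1 b)))
        (trans (cong (λ m → + 7 ℤ.* + m ℤ.+ + 3) eq) (cong (ℤ._+ + 3) (sym (pos-* 7 n)))))) }))
  where
  lemma : ∀ a b →
    (+ 7 ℤ.* a ℤ.+ + 1) ℤ.* (+ 7 ℤ.* a ℤ.+ + 1) ℤ.+ (+ 7 ℤ.* b ℤ.+ + 3) ℤ.* (+ 7 ℤ.* b ℤ.+ + 3)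
    ≡ + 7 ℤ.* (+ 1 ℤ.+ b ℤ.* (+ 7 ℤ.* b ℤ.+ + 6) ℤ.+ a ℤ.* (+ 7 ℤ.* a ℤ.+ + 2)) ℤ.+ + 3
  lemma = ℤ-solve-∀

-- The coefficients c 11 3 modulo 2

tri-suc : ∀ n → tri (suc n) ≡ suc n + tri n
tri-suc n = trans (cong (_/ 2) (lemma n))
  (trans (+-distrib-/-∣ˡ (n * suc n) (divides (suc n) refl)) (cong (_+ tri n) (m*n/n≡m (suc n) 2)))
  where
  lemma : ∀ n → suc n * suc (suc n) ≡ suc n * 2 + n * suc n
  lemma = ℕ-solve-∀

tri-suc∸ : ∀ n → tri (suc n) ∸ suc n ≡ tri n
tri-suc∸ n = trans (cong (_∸ suc n) (tri-suc n)) (m+n∸m≡n (suc n) (tri n))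

2*tri : ∀ n → 2 * tri n ≡ n * suc n
2*tri zero    = refl
2*tri (suc n) = trans (cong (2 *_) (tri-suc n))
  (trans (lemma₁ n (tri n)) (trans (cong (λ x → 2 * suc n + x) (2*tri n)) (lemma₂ n)))
  where
  lemma₁ : ∀ n t → 2 * (suc n + t) ≡ 2 * suc n + 2 * t
  lemma₁ = ℕ-solve-∀
  lemma₂ : ∀ n → 2 * suc n + n * suc n ≡ suc n * suc (suc n)
  lemma₂ = ℕ-solve-∀

-- The coefficients come from (11 + 3)/2 = 7 and (11 - 3)/2 = 4. The negative indices give the same
-- polynomial, so both sums join into one over ℤ.
posExponent : ∀ n → 11 * tri n + 3 * (tri n ∸ n) ≡ t (+ n)
posExponent zero    = refl
posExponent (suc n) = trans (cong₂ (λ x y → 11 * x + 3 * y) (tri-suc n) (tri-suc∸ n))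
  (trans (lemma₁ n (tri n)) (trans (cong (λ x → 11 * suc n + 7 * x) (2*tri n)) (lemma₂ n)))
  where
  lemma₁ : ∀ n t → 11 * (suc n + t) + 3 * t ≡ 11 * suc n + 7 * (2 * t)
  lemma₁ = ℕ-solve-∀
  lemma₂ : ∀ n → 11 * suc n + 7 * (n * suc n) ≡ suc n * (7 * suc n + 4)
  lemma₂ = ℕ-solve-∀

negExponent : ∀ n → 11 * (tri (suc n) ∸ suc n) + 3 * tri (suc n) ≡ t -[1+ n ]
negExponent n = trans (cong₂ (λ x y → 11 * y + 3 * x) (tri-suc n) (tri-suc∸ n))
  (trans (lemma₁ n (tri n)) (trans (cong (λ x → 3 * suc n + 7 * x) (2*tri n)) (lemma₂ n)))
  where
  lemma₁ : ∀ n t → 11 * t + 3 * (suc n + t) ≡ 3 * suc n + 7 * (2 * t)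
  lemma₁ = ℕ-solve-∀
  lemma₂ : ∀ n → 3 * suc n + 7 * (n * suc n) ≡ suc n * (3 + 7 * n)
  lemma₂ = ℕ-solve-∀

parity-signed-ind : ∀ a m N → parity (sgn a ℤ.* ind m N) ≡ monomial m N
parity-signed-ind a m N = trans (parity-* (sgn a) (ind m N)) (cong₂ _∧_ (parity-sgn a) parity-ind)
  where
  parity-sgn : ∀ a → parity (sgn a) ≡ true
  parity-sgn a with (a % 2) ≡ᵇ 0
  ... | true  = refl
  ... | false = refl
  parity-ind : parity (ind m N) ≡ monomial m N
  parity-ind with m ≡ᵇ N
  ... | true  = refl
  ... | false = refl

parity-sum : ∀ {A : Set} (f : A → ℤ) (e : A → ℕ) N → (∀ a → parity (f a) ≡ monomial (e a) N) →
             ∀ L → parity (sumℤ (map f L)) ≡ coeff e L N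
parity-sum f e N p []      = refl
parity-sum f e N p (a ∷ L) = trans (parity-+ (f a) (sumℤ (map f L))) (cong₂ _xor_ (p a) (parity-sum f e N p L))

-- Modulo 2 both the signs ±1 and the minus between the half-sums disappear, turning the false theta
-- function into the theta series `T`. The asymmetric `box N`, from -(N + 1) to N, has exactly the
-- index ranges of `psiCoeff`.
parity-psiCoeff : ∀ N → parity (psiCoeff 11 3 N) ≡ T N
parity-psiCoeff N = begin
  parity (psiCoeff 11 3 N)
    ≡⟨ parity-+ (sumℤ (map (posTerm 11 3 N) L)) (ℤ.- negSum) ⟩
  parity (sumℤ (map (posTerm 11 3 N) L)) xor parity (ℤ.- negSum)
    ≡⟨ cong₂ _xor_
         (parity-sum (posTerm 11 3 N) (t ∘ +_) N
           parity-posTerm L)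
         (trans (parity-neg negSum)
           (parity-sum (λ i → negTerm 11 3 N (suc i)) (t ∘ -[1+_]) N
             parity-negTerm L)) ⟩
  coeff (t ∘ +_) L N xor coeff (t ∘ -[1+_]) L N
    ≡⟨ sym (cong₂ _xor_ (coeff-map t +_ L N) (coeff-map t -[1+_] L N)) ⟩
  coeff t (map +_ L) N xor coeff t (map -[1+_] L) N
    ≡⟨ sym (coeff-++ t (map +_ L) (map -[1+_] L) N) ⟩
  T N ∎
  where
  open ≡-Reasoning
  L = upTo (suc N)
  negSum = sumℤ (map (λ i → negTerm 11 3 N (suc i)) L)
  parity-posTerm : ∀ n → parity (posTerm 11 3 N n) ≡ monomial (t (+ n)) N
  parity-posTerm n = trans
    (parity-signed-ind (tri n) (11 * tri n + 3 * (tri n ∸ n)) N)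
    (cong (λ m → monomial m N) (posExponent n))
  parity-negTerm : ∀ n → parity (negTerm 11 3 N (suc n)) ≡ monomial (t -[1+ n ]) N
  parity-negTerm n = trans
    (parity-signed-ind (tri (suc n) ∸ suc n) (11 * (tri (suc n) ∸ suc n) + 3 * tri (suc n)) N)
    (cong (λ m → monomial m N) (negExponent n))

-- The reciprocal modulo 2 and its coefficients at 8n + 4

D : Series
D N = parity (c 11 3 N)

-- `cList` stores the newest coefficient first, so zipping it with f in increasing order pairs f(i)
-- with c(N - i), as in a Cauchy product.
parity-convolution : ∀ f N → parity (sumℤ (zipWith ℤ._*_ (map f (upTo (suc N))) (cList 11 3 N)))
                           ≡ ((parity ∘ f) ⊛ D) N
parity-convolution f zero    = trans (parity-+ (f 0 ℤ.* + 1) (+ 0))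
  (trans (xor-identityʳ _) (parity-* (f 0) (+ 1)))
parity-convolution f (suc N) = trans
  (parity-+ (f 0 ℤ.* c 11 3 (suc N)) (sumℤ (zipWith ℤ._*_ (map f (applyUpTo suc (suc N))) (cList 11 3 N))))
  (cong₂ _xor_ (parity-* (f 0) (c 11 3 (suc N)))
    (trans (cong (λ L → parity (sumℤ (zipWith ℤ._*_ L (cList 11 3 N))))
             (trans (map-applyUpTo suc f (suc N)) (sym (map-upTo (f ∘ suc) (suc N)))))
           (parity-convolution (f ∘ suc) N)))

-- `T 0` evaluates to `true`, and the recursion for `c` makes the remaining part of each later
-- coefficient equal to `D (suc N)`, so the two cancel.
TD≗1 : T ⊛ D ≗ monomial 0
TD≗1 zero    = refl
TD≗1 (suc N) = trans (cong₂ _xor_ D-suc (refl {x = (tail T ⊛ D) N})) (xor-same ((tail T ⊛ D) N))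
  where
  D-suc : D (suc N) ≡ (tail T ⊛ D) N
  D-suc = trans
    (parity-neg (sumℤ (zipWith ℤ._*_ (map (λ i → psiCoeff 11 3 (suc i)) (upTo (suc N))) (cList 11 3 N))))
    (trans (parity-convolution (λ i → psiCoeff 11 3 (suc i)) N)
    (⊛-cong (parity-psiCoeff ∘ suc) (λ _ → refl) N))

-- Since 8n + 4 = 2(2(2n + 1)), this coefficient is reached by the sections even, even, odd.
c-even : ∀ n b u → 7 * n + 3 ≡ 2 ^ b * (3 + 4 * u) → + 2 ∣ c 11 3 (8 * n + 4)
c-even n b u eq = ¬isOdd⇒2∣ _ (begin
  D (8 * n + 4)                  ≡⟨ cong D (index n) ⟩
  odd (even (even D)) n          ≡⟨ reciprocal-section TD≗1 even-T odd-ST n ⟩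
  (W ⊛ S) n                      ≡⟨ WS-vanishes n (λ □ → 2^b[3+4t]-notSumOfTwoSquares b u
                                      (subst SumOfTwoSquares (cong +_ eq) □)) ⟩
  false                          ∎)
  where
  open ≡-Reasoning
  double≡ : ∀ n → double n ≡ 2 * n
  double≡ n = +-injective (trans (+-double n) (sym (pos-* 2 n)))
  lemma : ∀ n → 8 * n + 4 ≡ 2 * (2 * (1 + 2 * n))
  lemma = ℕ-solve-∀
  index : ∀ n → 8 * n + 4 ≡ double (double (suc (double n)))
  index n = trans (lemma n) (sym (trans (double≡ (double (suc (double n))))
    (cong (2 *_) (trans (double≡ (suc (double n))) (cong (λ x → 2 * suc x) (double≡ n))))))

-- As 8 ≡ 1 modulo 7, raising the exponent of 2 in steps of 3 preserves divisibility by 7 in the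
-- progressions.
8^k≡1+7g : ∀ k → ∃ λ g → 8 ^ k ≡ 1 + 7 * g
8^k≡1+7g zero    = 0 , refl
8^k≡1+7g (suc k) with 8^k≡1+7g k
... | g , eq = 1 + 8 * g , trans (cong (8 *_) eq) (lemma g)
  where
  lemma : ∀ g → 8 * (1 + 7 * g) ≡ 1 + 7 * (1 + 8 * g)
  lemma = ℕ-solve-∀

-- One proof for the three progressions, with v = 3 + 4u. The hypothesis 2^i v ≡ 3 (mod 7) makes the
-- division by 7 exact.
c-even-family : ∀ i u q n k → 2 ^ i * (3 + 4 * u) ≡ 3 + 7 * q →
  + 2 ∣ c 11 3 (2 ^ (3 * k + (5 + i)) * n + ((3 + 4 * u) * 2 ^ (3 * k + (3 + i)) + 4) / 7)
c-even-family i u q n k hq with g , 8^k≡ ← 8^k≡1+7g k =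
  subst (λ m → + 2 ∣ c 11 3 m) (sym index) (c-even M (3 * k + i) (u + 7 * n) 7M+3)
  where
  open ≡-Reasoning
  X = 2 ^ (3 * k)
  X≡ : X ≡ 1 + 7 * g
  X≡ = trans (sym (^-*-assoc 2 3 k)) 8^k≡
  I = 2 ^ i
  v = 3 + 4 * u
  -- `M₀` is (2^(3k + i) v - 3)/7, and `M` is chosen so that the index of `c` is 8M + 4; then 7M + 3
  -- = 2^(3k + i)(v + 28n).
  M₀ = I * v * g + q
  M = 4 * (X * I * n) + M₀
  quotient : (v * 2 ^ (3 * k + (3 + i)) + 4) / 7 ≡ 8 * M₀ + 4
  quotient = trans (cong (_/ 7) (begin
    v * 2 ^ (3 * k + (3 + i)) + 4        ≡⟨ cong (λ x → v * x + 4) (^-distribˡ-+-* 2 (3 * k) (3 + i)) ⟩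
    v * (X * (2 * (2 * (2 * I)))) + 4    ≡⟨ cong (λ x → v * (x * (2 * (2 * (2 * I)))) + 4) X≡ ⟩
    v * ((1 + 7 * g) * (2 * (2 * (2 * I)))) + 4 ≡⟨ lemma₁ v g I ⟩
    8 * (I * v) + 56 * (I * v * g) + 4   ≡⟨ cong (λ x → 8 * x + 56 * (I * v * g) + 4) hq ⟩
    8 * (3 + 7 * q) + 56 * (I * v * g) + 4 ≡⟨ lemma₂ (I * v * g) q ⟩
    (8 * M₀ + 4) * 7                     ∎)) (m*n/n≡m (8 * M₀ + 4) 7)
    where
    lemma₁ : ∀ v g I → v * ((1 + 7 * g) * (2 * (2 * (2 * I)))) + 4 ≡ 8 * (I * v) + 56 * (I * v * g) + 4
    lemma₁ = ℕ-solve-∀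
    lemma₂ : ∀ x q → 8 * (3 + 7 * q) + 56 * x + 4 ≡ (8 * (x + q) + 4) * 7
    lemma₂ = ℕ-solve-∀
  index : 2 ^ (3 * k + (5 + i)) * n + (v * 2 ^ (3 * k + (3 + i)) + 4) / 7 ≡ 8 * M + 4
  index = trans (cong₂ (λ x y → x * n + y) (^-distribˡ-+-* 2 (3 * k) (5 + i)) quotient) (lemma X I n M₀)
    where
    lemma : ∀ X I n M₀ → X * (2 * (2 * (2 * (2 * (2 * I))))) * n + (8 * M₀ + 4) ≡ 8 * (4 * (X * I * n) + M₀) + 4
    lemma = ℕ-solve-∀
  7M+3 : 7 * M + 3 ≡ 2 ^ (3 * k + i) * (3 + 4 * (u + 7 * n))
  7M+3 = begin
    7 * M + 3                                     ≡⟨ lemma₁ (X * I * n) (I * v * g) q ⟩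
    28 * (X * I * n) + 7 * (I * v * g) + (3 + 7 * q)
      ≡⟨ cong (λ x → 28 * (X * I * n) + 7 * (I * v * g) + x) (sym hq) ⟩
    28 * (X * I * n) + 7 * (I * v * g) + I * v    ≡⟨ lemma₂ (X * I * n) (I * v) g ⟩
    28 * (X * I * n) + (1 + 7 * g) * (I * v)      ≡⟨ cong (λ x → 28 * (X * I * n) + x * (I * v)) (sym X≡) ⟩
    28 * (X * I * n) + X * (I * v)                ≡⟨ lemma₃ X I n u ⟩
    X * I * (3 + 4 * (u + 7 * n))
      ≡⟨ cong (_* (3 + 4 * (u + 7 * n))) (sym (^-distribˡ-+-* 2 (3 * k) i)) ⟩
    2 ^ (3 * k + i) * (3 + 4 * (u + 7 * n))       ∎
    where
    lemma₁ : ∀ x y q → 7 * (4 * x + (y + q)) + 3 ≡ 28 * x + 7 * y + (3 + 7 * q)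
    lemma₁ = ℕ-solve-∀
    lemma₂ : ∀ x y g → 28 * x + 7 * (y * g) + y ≡ 28 * x + (1 + 7 * g) * y
    lemma₂ = ℕ-solve-∀
    lemma₃ : ∀ X I n u → 28 * (X * I * n) + X * (I * (3 + 4 * u)) ≡ X * I * (3 + 4 * (u + 7 * n))
    lemma₃ = ℕ-solve-∀

theorem5p1 : (n k : ℕ) →
    ((+ 2) ∣ c 11 3 (2 ^ (3 * k + 5) * n + (3 * 2 ^ (3 * k + 3) + 4) / 7))
    × ((+ 2) ∣ c 11 3 (2 ^ (3 * k + 6) * n + (19 * 2 ^ (3 * k + 4) + 4) / 7))
    × ((+ 2) ∣ c 11 3 (2 ^ (3 * k + 7) * n + (27 * 2 ^ (3 * k + 5) + 4) / 7))
-- Here v is 3, 19, 27, and 2^i v is 3, 38, 108, that is 3 + 7q with q = 0, 5, 15.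
theorem5p1 n k = c-even-family 0 0 0 n k refl , c-even-family 1 4 5 n k refl , c-even-family 2 6 15 n k refl
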